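{- Let $\mathcal{B}=\{(b,m): m>1,\ b\in B_m\}$. Let $\cong$ be the equivalence relation on $\mathcal{B}$ generated by: (1) for $m>1$ and $a,b\in B_m$, $(b,m)\cong(aba^{ -1},m)$; (2) for $m>1$ and any word $\prod_{k=1}^{\ell}\sigma_{i_k}^{\epsilon_k}$ with $1\le i_k\le m-1$, $\epsilon_k\in\{1,-1\}$, $\left(\prod_{k=1}^{\ell}\sigma_{i_k}^{\epsilon_k},m\right)\cong\left(\sigma_1\prod_{k=1}^{\ell}\sigma_{i_k+1}^{\epsilon_k},m+1\right)$; (3) for such words, $\left(\prod_{k=1}^{\ell}\sigma_{i_k}^{\epsilon_k},m\right)\cong\left(\sigma_1^{ -1}\prod_{k=1}^{\ell}\sigma_{i_k+1}^{\epsilon_k},m+1\right)$. Then $\cong$ coincides with the Markov equivalence $\sim$ on $\mathcal{B}$.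
   Context: For $n\ge 2$, $B_n$ is the braid group with generators $\sigma_1,\dots,\sigma_{n-1}$ and relations $\sigma_i\sigma_j=\sigma_j\sigma_i$ for $|i-j|\ge 2$ and $\sigma_i\sigma_{i+1}\sigma_i=\sigma_{i+1}\sigma_i\sigma_{i+1}$. For $m<n$, $B_m$ is identified with its image in $B_n$ under the homomorphism sending $\sigma_i\mapsto\sigma_i$. The Markov equivalence $\sim$ on $\mathcal{B}$ is the equivalence relation generated by: $(b,m)\sim(aba^{ -1},m)$ for $a,b\in B_m$; $(b,m)\sim(\sigma_m b,m+1)$ for $b\in B_m$; $(b,m)\sim(\sigma_m^{ -1}b,m+1)$ for $b\in B_m$. -}

module Defs where

open import Algebra.Bundles using (Group)
open import Algebra.Morphism.Structures using (module GroupMorphisms)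
open import Data.List.Base using (List; []; _∷_; [_]; _++_; map)
open import Data.List.Properties using (++-assoc; ++-identityʳ; map-++)
open import Data.Nat.Base using (ℕ; suc; _≤_; _<_; ∣_-_∣; s≤s; z≤n)
open import Data.Nat.Properties using (<-≤-trans; n≤1+n; m<n⇒m<1+n; <⇒≤; n<1+n)
open import Data.Product.Base using (_×_; _,_; map₁)
open import Data.Sign.Base using (Sign; opposite)
open import Level using (0ℓ)
open import Relation.Binary.Construct.Closure.Equivalence using (EqClosure)
open import Relation.Binary.Core using (Rel)
open import Relation.Binary.PropositionalEquality.Core using (_≡_; refl; cong; sym; trans)

-- ⟪ i ⟫ is σ_i, with the usual 1-based numbering 1 ≤ i ≤ n - 1.
record Generator (n : ℕ) : Set where
  constructor ⟪_⟫
  field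
    index      : ℕ
    .{index≥1} : 1 ≤ index
    .{index<n} : index < n

open Generator public using (index)

-- The letter (g , s) stands for g^s with s = ±1, and a list of letters for
-- their product from left to right.
Letter : ℕ → Set
Letter n = Generator n × Sign

Word : ℕ → Set
Word n = List (Letter n)

gen : ∀ {n} → Generator n → Word n
gen g = [ (g , Sign.+) ]

invert : ∀ {n} → Word n → Word n
invert []            = []
invert ((g , s) ∷ w) = invert w ++ [ (g , opposite s) ]

infix 4 _≈_

-- Equality in the braid group: the congruence on words generated by free
-- cancellation and the braid relations.
data _≈_ {n : ℕ} : Rel (Word n) 0ℓ where
  ≈-refl  : ∀ {u} → u ≈ u
  ≈-sym   : ∀ {u v} → u ≈ v → v ≈ u
  ≈-trans : ∀ {u v w} → u ≈ v → v ≈ w → u ≈ w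
  ++-cong : ∀ {u u′ v v′} → u ≈ u′ → v ≈ v′ → u ++ v ≈ u′ ++ v′
  cancel  : ∀ g s → (g , s) ∷ (g , opposite s) ∷ [] ≈ []
  commute : ∀ g h → 2 ≤ ∣ index g - index h ∣ →
            gen g ++ gen h ≈ gen h ++ gen g
  braid   : ∀ g h → index h ≡ suc (index g) →
            gen g ++ gen h ++ gen g ≈ gen h ++ gen g ++ gen h

≈-reflexive : ∀ {n} {u v : Word n} → u ≡ v → u ≈ v
≈-reflexive refl = ≈-refl

cancel′ : ∀ {n} (g : Generator n) s → (g , opposite s) ∷ (g , s) ∷ [] ≈ []
cancel′ g Sign.+ = cancel g Sign.-
cancel′ g Sign.- = cancel g Sign.+

invertˡ : ∀ {n} (w : Word n) → invert w ++ w ≈ []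
invertˡ []            = ≈-refl
invertˡ ((g , s) ∷ w) =
  ≈-trans (≈-reflexive (++-assoc (invert w) [ (g , opposite s) ] ((g , s) ∷ w)))
  (≈-trans (++-cong (≈-refl {u = invert w}) (++-cong (cancel′ g s) (≈-refl {u = w})))
  (invertˡ w))

invertʳ : ∀ {n} (w : Word n) → w ++ invert w ≈ []
invertʳ []            = ≈-refl
invertʳ ((g , s) ∷ w) =
  ≈-trans (≈-reflexive (cong ((g , s) ∷_) (sym (++-assoc w (invert w) [ (g , opposite s) ]))))
  (≈-trans (++-cong (≈-refl {u = [ (g , s) ]})
                    (++-cong (invertʳ w) (≈-refl {u = [ (g , opposite s) ]})))
  (cancel g s))

invert-cong : ∀ {n} {u v : Word n} → u ≈ v → invert u ≈ invert v
invert-cong {u = u} {v} u≈v =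
  ≈-trans (≈-reflexive (sym (++-identityʳ (invert u))))
  (≈-trans (++-cong (≈-refl {u = invert u}) (≈-sym (invertʳ v)))
  (≈-trans (++-cong (≈-refl {u = invert u}) (++-cong (≈-sym u≈v) (≈-refl {u = invert v})))
  (≈-trans (≈-reflexive (sym (++-assoc (invert u) u (invert v))))
  (++-cong (invertˡ u) (≈-refl {u = invert v})))))

-- The braid group B_n, for n ≥ 2 (trivial for n ≤ 1).
B : ℕ → Group 0ℓ 0ℓ
B n = record
  { Carrier = Word n
  ; _≈_     = _≈_
  ; _∙_     = _++_
  ; ε       = []
  ; _⁻¹     = invert
  ; isGroup = record
    { isMonoid = record
      { isSemigroup = record
        { isMagma = record
          { isEquivalence = record { refl = ≈-refl ; sym = ≈-sym ; trans = ≈-trans }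
          ; ∙-cong        = ++-cong
          }
        ; assoc = λ u v w → ≈-reflexive (++-assoc u v w)
        }
      ; identity = (λ _ → ≈-refl) , (λ w → ≈-reflexive (++-identityʳ w))
      }
    ; inverse = invertˡ , invertʳ
    ; ⁻¹-cong = invert-cong
    }
  }

module _ {n : ℕ} where
  open Group (B n) public using (_∙_; _⁻¹)

ι-gen : ∀ {m n} → .(m ≤ n) → Generator m → Generator n
ι-gen m≤n (⟪ i ⟫ {p} {q}) = ⟪ i ⟫ {p} {<-≤-trans q m≤n}

-- B_m → B_n, σ_i ↦ σ_i.
ι : ∀ {m n} → .(m ≤ n) → Word m → Word n
ι m≤n = map (map₁ (ι-gen m≤n))

ι-cong : ∀ {m n} .(m≤n : m ≤ n) {u v : Word m} → u ≈ v → ι m≤n u ≈ ι m≤n v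
ι-cong m≤n ≈-refl        = ≈-refl
ι-cong m≤n (≈-sym p)     = ≈-sym (ι-cong m≤n p)
ι-cong m≤n (≈-trans p q) = ≈-trans (ι-cong m≤n p) (ι-cong m≤n q)
ι-cong m≤n (++-cong {u} {u′} {v} {v′} p q) =
  ≈-trans (≈-reflexive (map-++ _ u v))
  (≈-trans (++-cong (ι-cong m≤n p) (ι-cong m≤n q))
  (≈-reflexive (sym (map-++ _ u′ v′))))
ι-cong m≤n (cancel g s)    = cancel (ι-gen m≤n g) s
ι-cong m≤n (commute g h d) = commute (ι-gen m≤n g) (ι-gen m≤n h) d
ι-cong m≤n (braid g h e)   = braid (ι-gen m≤n g) (ι-gen m≤n h) e

ι-invert : ∀ {m n} .(m≤n : m ≤ n) (w : Word m) → ι m≤n (invert w) ≡ invert (ι m≤n w)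
ι-invert m≤n []            = refl
ι-invert m≤n ((g , s) ∷ w) =
  trans (map-++ _ (invert w) [ (g , opposite s) ])
        (cong (_++ [ (ι-gen m≤n g , opposite s) ]) (ι-invert m≤n w))

ι-isGroupHomomorphism : ∀ {m n} .(m≤n : m ≤ n) →
  GroupMorphisms.IsGroupHomomorphism (Group.rawGroup (B m)) (Group.rawGroup (B n)) (ι m≤n)
ι-isGroupHomomorphism m≤n = record
  { isMonoidHomomorphism = record
    { isMagmaHomomorphism = record
      { isRelHomomorphism = record { cong = ι-cong m≤n }
      ; homo              = λ u v → ≈-reflexive (map-++ _ u v)
      }
    ; ε-homo = ≈-refl
    }
  ; ⁻¹-homo = λ w → ≈-reflexive (ι-invert m≤n w)
  }

shift-gen : ∀ {m} → Generator m → Generator (suc m)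
shift-gen (⟪ i ⟫ {p} {q}) = ⟪ suc i ⟫ {s≤s z≤n} {s≤s q}

-- ∏ σ_{i_k}^{ε_k} ↦ ∏ σ_{i_k + 1}^{ε_k}.
shift : ∀ {m} → Word m → Word (suc m)
shift = map (map₁ shift-gen)

σ-first : ∀ {m} → .(1 < m) → Generator (suc m)
σ-first m>1 = ⟪ 1 ⟫ {s≤s z≤n} {m<n⇒m<1+n m>1}

σ-last : ∀ {m} → .(1 < m) → Generator (suc m)
σ-last {m} m>1 = ⟪ m ⟫ {<⇒≤ m>1} {n<1+n m}

-- The pairs (b , m). The field element holds a representative of an element of
-- B_m, so the intended equality on 𝓑 is equality of strands together with _≈_.
record 𝓑 : Set where
  constructor ⟨_,_,_⟩
  field
    strands    : ℕ
    element    : Group.Carrier (B strands)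
    .strands>1 : 1 < strands

-- In both generating relations below the constructor `same` makes the generated
-- equivalence contain the equality of B_m, i.e. makes it a relation on pairs
-- (b , m) with b an element of B_m rather than a word.
data MarkovStep : Rel 𝓑 0ℓ where
  same : ∀ m .(m>1 : 1 < m) {b b′ : Word m} → b ≈ b′ →
         MarkovStep ⟨ m , b , m>1 ⟩ ⟨ m , b′ , m>1 ⟩
  conj : ∀ m .(m>1 : 1 < m) (a b : Word m) →
         MarkovStep ⟨ m , b , m>1 ⟩ ⟨ m , a ∙ b ∙ a ⁻¹ , m>1 ⟩
  stab⁺ : ∀ m .(m>1 : 1 < m) (b : Word m) →
          MarkovStep ⟨ m , b , m>1 ⟩
                     ⟨ suc m , gen (σ-last m>1) ∙ ι (n≤1+n m) b , m<n⇒m<1+n m>1 ⟩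
  stab⁻ : ∀ m .(m>1 : 1 < m) (b : Word m) →
          MarkovStep ⟨ m , b , m>1 ⟩
                     ⟨ suc m , gen (σ-last m>1) ⁻¹ ∙ ι (n≤1+n m) b , m<n⇒m<1+n m>1 ⟩

data ShiftStep : Rel 𝓑 0ℓ where
  same : ∀ m .(m>1 : 1 < m) {b b′ : Word m} → b ≈ b′ →
         ShiftStep ⟨ m , b , m>1 ⟩ ⟨ m , b′ , m>1 ⟩
  conj : ∀ m .(m>1 : 1 < m) (a b : Word m) →
         ShiftStep ⟨ m , b , m>1 ⟩ ⟨ m , a ∙ b ∙ a ⁻¹ , m>1 ⟩
  stab⁺ : ∀ m .(m>1 : 1 < m) (w : Word m) →
          ShiftStep ⟨ m , w , m>1 ⟩
                    ⟨ suc m , gen (σ-first m>1) ∙ shift w , m<n⇒m<1+n m>1 ⟩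
  stab⁻ : ∀ m .(m>1 : 1 < m) (w : Word m) →
          ShiftStep ⟨ m , w , m>1 ⟩
                    ⟨ suc m , gen (σ-first m>1) ⁻¹ ∙ shift w , m<n⇒m<1+n m>1 ⟩

infix 4 _∼_ _≅_

_∼_ : Rel 𝓑 0ℓ
_∼_ = EqClosure MarkovStep

_≅_ : Rel 𝓑 0ℓ
_≅_ = EqClosure ShiftStep

{-# OPTIONS --safe #-}
module Submission where

-- Conjugation by the half twist Δ is the automorphism flip of B_n sending σ_i
-- to σ_{n-i}, so every braid is conjugate to its flip. Since flip exchanges
-- σ_1 · shift w and σ_m · ι (flip w) in B_{m+1}, the two kinds of
-- stabilisation agree up to conjugation.

open import Defs
open import Algebra.Bundles using (Group)
open import Data.List.Base using ([]; _∷_; [_]; _++_; map; reverse)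
open import Data.List.Properties using (++-assoc; ++-identityʳ; map-∘; map-cong; map-id; reverse-++)
open import Data.Nat.Base using (ℕ; zero; suc; _+_; _∸_; _≤_; _<_; s≤s; z≤n)
open import Data.Nat.Properties using (≤-refl; ≤-trans; ≤-reflexive; n≤1+n; <⇒≤; ≤-pred; suc-injective; m≤n⇒m<n∨m≡n; m<n⇒0<n∸m; ∸-monoʳ-<; m∸[m∸n]≡n; m+[n∸m]≡n; m≤n⇒∣n-m∣≡n∸m; m+n≤o⇒m≤o∸n; m≤n+m; +-comm; +-suc; +-monoˡ-≤; _≤?_)
open import Data.Product.Base using (_,_; map₁)
open import Data.Sign.Base using (Sign)
open import Data.Sum.Base using (inj₁; inj₂)
open import Function.Bundles using (_⇔_; mk⇔)
open import Relation.Binary.Core using (_⇒_)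
open import Relation.Binary.Construct.Closure.Equivalence using (fold; return; symmetric; isEquivalence)
open import Relation.Binary.Construct.Closure.ReflexiveTransitive using (_◅◅_)
open import Relation.Binary.PropositionalEquality.Core using (_≡_; refl; cong; sym; trans; subst)
open import Relation.Nullary.Decidable.Core using (recompute)
import Relation.Binary.Reasoning.Setoid as SetoidReasoning

module ≈-Reasoning {n : ℕ} = SetoidReasoning (Group.setoid (B n))

-- Conjugation and reversal in the braid group.

module _ {n : ℕ} where

  ++-congˡ : ∀ (u : Word n) {v w} → v ≈ w → u ++ v ≈ u ++ w
  ++-congˡ u = ++-cong (≈-refl {u = u})

  ++-congʳ : ∀ (u : Word n) {v w} → v ≈ w → v ++ u ≈ w ++ u
  ++-congʳ u v≈w = ++-cong v≈w (≈-refl {u = u})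

  assoc : ∀ (u v w : Word n) → (u ++ v) ++ w ≈ u ++ (v ++ w)
  assoc u v w = ≈-reflexive (++-assoc u v w)

  generator-≡ : {g h : Generator n} → index g ≡ index h → g ≡ h
  generator-≡ refl = refl

  -- The bounds stored in a generator are irrelevant; decidability of the order makes them available
  -- to relevant arguments.
  index-≥1 : (g : Generator n) → 1 ≤ index g
  index-≥1 (⟪ i ⟫ {p}) = recompute (1 ≤? i) p

  index-< : (g : Generator n) → index g < n
  index-< (⟪ i ⟫ {_} {q}) = recompute (suc i ≤? n) q

  -- Each defining relation read backwards is again a relation: the braid relation is palindromic, a
  -- commutation swaps its sides, and a cancellation starts with the other sign. Hence reversal is
  -- an anti-automorphism of B_n.
  reverse-cong : {u v : Word n} → u ≈ v → reverse u ≈ reverse v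
  reverse-cong ≈-refl        = ≈-refl
  reverse-cong (≈-sym p)     = ≈-sym (reverse-cong p)
  reverse-cong (≈-trans p q) = ≈-trans (reverse-cong p) (reverse-cong q)
  reverse-cong (++-cong {u} {u′} {v} {v′} p q) = begin
    reverse (u ++ v)         ≡⟨ reverse-++ u v ⟩
    reverse v ++ reverse u   ≈⟨ ++-cong (reverse-cong q) (reverse-cong p) ⟩
    reverse v′ ++ reverse u′ ≡⟨ reverse-++ u′ v′ ⟨
    reverse (u′ ++ v′)       ∎
    where open ≈-Reasoning
  reverse-cong (cancel g s)    = cancel′ g s
  reverse-cong (commute g h d) = ≈-sym (commute g h d)
  reverse-cong (braid g h e)   = braid g h e

  -- The equation u a u⁻¹ = b cleared of inverses, so that conjugations compose by reassociation
  -- alone.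
  Carries : Word n → Word n → Word n → Set
  Carries u a b = u ++ a ≈ b ++ u

  carries-++ : ∀ {a b c} u v → Carries v a b → Carries u b c → Carries (u ++ v) a c
  carries-++ {a} {b} {c} u v va≈bv ub≈cu = begin
    (u ++ v) ++ a ≈⟨ assoc u v a ⟩
    u ++ (v ++ a) ≈⟨ ++-congˡ u va≈bv ⟩
    u ++ (b ++ v) ≈⟨ assoc u b v ⟨
    (u ++ b) ++ v ≈⟨ ++-congʳ v ub≈cu ⟩
    (c ++ u) ++ v ≈⟨ assoc c u v ⟩
    c ++ (u ++ v) ∎
    where open ≈-Reasoning

  carries-product : ∀ {u} a a′ b b′ → Carries u a b → Carries u a′ b′ → Carries u (a ++ a′) (b ++ b′)
  carries-product {u} a a′ b b′ p q = begin
    u ++ (a ++ a′) ≈⟨ assoc u a a′ ⟨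
    (u ++ a) ++ a′ ≈⟨ ++-congʳ a′ p ⟩
    (b ++ u) ++ a′ ≈⟨ assoc b u a′ ⟩
    b ++ (u ++ a′) ≈⟨ ++-congˡ b q ⟩
    b ++ (b′ ++ u) ≈⟨ assoc b b′ u ⟨
    (b ++ b′) ++ u ∎
    where open ≈-Reasoning

  carries-invert : ∀ {u} a b → Carries u a b → Carries u (invert a) (invert b)
  carries-invert {u} a b p = begin
    u ++ invert a                          ≈⟨ ++-congʳ (u ++ invert a) (invertˡ b) ⟨
    (invert b ++ b) ++ (u ++ invert a)     ≈⟨ assoc (invert b) b (u ++ invert a) ⟩
    invert b ++ (b ++ (u ++ invert a))     ≈⟨ ++-congˡ (invert b) (assoc b u (invert a)) ⟨
    invert b ++ ((b ++ u) ++ invert a)     ≈⟨ ++-congˡ (invert b) (++-congʳ (invert a) p) ⟨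
    invert b ++ ((u ++ a) ++ invert a)     ≈⟨ ++-congˡ (invert b) (assoc u a (invert a)) ⟩
    invert b ++ (u ++ (a ++ invert a))     ≈⟨ ++-congˡ (invert b) (++-congˡ u (invertʳ a)) ⟩
    invert b ++ (u ++ [])                  ≡⟨ cong (invert b ++_) (++-identityʳ u) ⟩
    invert b ++ u                          ∎
    where open ≈-Reasoning

  carries⇒conjugate : ∀ {u a b} → Carries u a b → u ∙ a ∙ u ⁻¹ ≈ b
  carries⇒conjugate {u} {a} {b} p = begin
    (u ++ a) ++ invert u ≈⟨ ++-congʳ (invert u) p ⟩
    (b ++ u) ++ invert u ≈⟨ assoc b u (invert u) ⟩
    b ++ (u ++ invert u) ≈⟨ ++-congˡ b (invertʳ u) ⟩
    b ++ []              ≡⟨ ++-identityʳ b ⟩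
    b                    ∎
    where open ≈-Reasoning

  -- The half twist and its action on the generators.

  -- Zero-based: σ i is the paper's σ_{i+1}.
  σ : ∀ i → .(suc i < n) → Generator n
  σ i q = ⟪ suc i ⟫ {s≤s z≤n} {q}

  -- δ k = σ_1 σ_2 ⋯ σ_k, and Δ k is the half twist on the first k + 1 strands.
  δ : ∀ k → .(k < n) → Word n
  δ zero    _ = []
  δ (suc k) q = δ k (<⇒≤ q) ++ gen (σ k q)

  Δ : ∀ k → .(k < n) → Word n
  Δ zero    _ = []
  Δ (suc k) q = δ (suc k) q ++ Δ k (<⇒≤ q)

  far : (g h : Generator n) → 2 + index g ≤ index h → gen g ++ gen h ≈ gen h ++ gen g
  far g h d = ≈-sym (commute h g
    (subst (2 ≤_) (sym (m≤n⇒∣n-m∣≡n∸m (<⇒≤ (<⇒≤ d)))) (m+n≤o⇒m≤o∸n 2 d)))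

  -- Only σ_1, ..., σ_k occur in `δ k`, and each of them commutes with `g`. The same holds for `Δ k`
  -- below.
  δ-far : ∀ k .(q : k < n) (g : Generator n) → 2 + k ≤ index g → Carries (δ k q) (gen g) (gen g)
  δ-far zero    q g _ = ≈-refl
  δ-far (suc k) q g d = carries-++ (δ k _) (gen (σ k q)) (far (σ k q) g d) (δ-far k _ g (<⇒≤ d))

  Δ-far : ∀ k .(q : k < n) (g : Generator n) → 2 + k ≤ index g → Carries (Δ k q) (gen g) (gen g)
  Δ-far zero    q g _ = ≈-refl
  Δ-far (suc k) q g d = carries-++ {b = gen g} {c = gen g} (δ (suc k) q) (Δ k _) (Δ-far k _ g (<⇒≤ d)) (δ-far (suc k) q g d)

  -- Induction on `k`. If `h` lies below the last letter of `δ k`, that letter commutes with `g` and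
  -- can be stripped. Otherwise `δ k` ends in `g h`, and the braid relation applies.
  δ-carries : ∀ k .(q : k < n) (g h : Generator n) → index h ≡ suc (index g) → index h ≤ k →
              Carries (δ k q) (gen g) (gen h)
  δ-carries zero    q g (⟪ .(suc (index g)) ⟫) refl ()
  δ-carries (suc k) q g h e h≤1+k with m≤n⇒m<n∨m≡n h≤1+k
  ... | inj₁ h<1+k = carries-++ (δ k _) (gen (σ k q))
    (≈-sym (far g (σ k q) (subst (_≤ suc k) (cong suc e) h<1+k)))
    (δ-carries k _ g h e (≤-pred h<1+k))
  δ-carries (suc zero) q g h e _ | inj₂ h≡1 with index-≥1 g | suc-injective (trans (sym e) h≡1)
  ... | g≥1 | g≡0 with () ← subst (1 ≤_) g≡0 g≥1
  δ-carries (suc (suc k)) q g h e _ | inj₂ h≡2+k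
    -- Here `g` and `h` are the last two letters. From g h g = h g h, the pair `g h` carries `g` to
    -- `h`, and `h` commutes with the remaining factor `δ k`.
    with refl ← generator-≡ {g = g} {h = σ k (<⇒≤ q)} (suc-injective (trans (sym e) h≡2+k))
       | refl ← generator-≡ {g = h} {h = σ (suc k) q} h≡2+k = begin
    ((δ k _ ++ gen g) ++ gen h) ++ gen g ≈⟨ ++-congʳ (gen g) (assoc (δ k _) (gen g) (gen h)) ⟩
    (δ k _ ++ (gen g ++ gen h)) ++ gen g ≈⟨ carries-++ (δ k _) (gen g ++ gen h) (braid g h refl) (δ-far k _ h ≤-refl) ⟩
    gen h ++ (δ k _ ++ (gen g ++ gen h)) ≈⟨ ++-congˡ (gen h) (assoc (δ k _) (gen g) (gen h)) ⟨
    gen h ++ ((δ k _ ++ gen g) ++ gen h) ∎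
    where open ≈-Reasoning

  -- Induction reaching two levels down: rewriting the trailing `Δ₁` as `Δ₀ ++ reverse δ₁` puts `s`
  -- next to `Δ₀`, with which it commutes. Then `δ₁ ++ Δ₀` is `Δ₁`, and `s ++ reverse δ₁` is the
  -- reverse of `δ₁ ++ s`.
  Δ-reverse : ∀ k .(q : k < n) → reverse (Δ k q) ≈ Δ k q
  Δ-reverse zero          q = ≈-refl
  Δ-reverse (suc zero)    q = ≈-refl
  Δ-reverse (suc (suc k)) q = ≈-sym (begin
    (δ₁ ++ s) ++ Δ₁                         ≈⟨ ++-congˡ (δ₁ ++ s) (Δ-reverse (suc k) _) ⟨
    (δ₁ ++ s) ++ reverse Δ₁                 ≡⟨ cong ((δ₁ ++ s) ++_) (reverse-++ δ₁ Δ₀) ⟩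
    (δ₁ ++ s) ++ (reverse Δ₀ ++ reverse δ₁) ≈⟨ ++-congˡ (δ₁ ++ s) (++-congʳ (reverse δ₁) (Δ-reverse k _)) ⟩
    (δ₁ ++ s) ++ (Δ₀ ++ reverse δ₁)         ≈⟨ assoc (δ₁ ++ s) Δ₀ (reverse δ₁) ⟨
    ((δ₁ ++ s) ++ Δ₀) ++ reverse δ₁         ≈⟨ ++-congʳ (reverse δ₁) (assoc δ₁ s Δ₀) ⟩
    (δ₁ ++ (s ++ Δ₀)) ++ reverse δ₁         ≈⟨ ++-congʳ (reverse δ₁) (++-congˡ δ₁ (Δ-far k _ (σ (suc k) q) ≤-refl)) ⟨
    (δ₁ ++ (Δ₀ ++ s)) ++ reverse δ₁         ≈⟨ ++-congʳ (reverse δ₁) (assoc δ₁ Δ₀ s) ⟨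
    (Δ₁ ++ s) ++ reverse δ₁                 ≈⟨ assoc Δ₁ s (reverse δ₁) ⟩
    Δ₁ ++ (s ++ reverse δ₁)                 ≡⟨ cong (Δ₁ ++_) (reverse-++ δ₁ s) ⟨
    Δ₁ ++ reverse (δ₁ ++ s)                 ≈⟨ ++-congʳ (reverse (δ₁ ++ s)) (Δ-reverse (suc k) _) ⟨
    reverse Δ₁ ++ reverse (δ₁ ++ s)         ≡⟨ reverse-++ (δ₁ ++ s) Δ₁ ⟨
    reverse ((δ₁ ++ s) ++ Δ₁)               ∎)
    where
    open ≈-Reasoning
    δ₁ = δ (suc k) (<⇒≤ q)
    s  = gen (σ (suc k) q)
    Δ₁ = Δ (suc k) (<⇒≤ q)
    Δ₀ = Δ k (<⇒≤ (<⇒≤ q))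

  -- Reversing Δ g = h Δ gives g Δ = Δ h, because Δ is a palindrome in B_n.
  Δ-carries-reverse : ∀ k .(q : k < n) (g h : Generator n) →
                      Carries (Δ k q) (gen g) (gen h) → Carries (Δ k q) (gen h) (gen g)
  Δ-carries-reverse k q g h p = begin
    Δ k q ++ gen h           ≈⟨ ++-congʳ (gen h) (Δ-reverse k q) ⟨
    reverse (Δ k q) ++ gen h ≡⟨ reverse-++ (gen h) (Δ k q) ⟨
    reverse (gen h ++ Δ k q) ≈⟨ reverse-cong p ⟨
    reverse (Δ k q ++ gen g) ≡⟨ reverse-++ (Δ k q) (gen g) ⟩
    gen g ++ reverse (Δ k q) ≈⟨ ++-congˡ (gen g) (Δ-reverse k q) ⟩
    gen g ++ Δ k q           ∎
    where open ≈-Reasoning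

  -- If index h ≥ 2, then g passes through Δ (k - 1) and then through δ k. If
  -- index h = 1, the case with g and h exchanged is reversed, Δ k being a palindrome in B_n.
  mutual

    Δ-carries : ∀ k .(q : k < n) (g h : Generator n) → index g + index h ≡ suc k →
                Carries (Δ k q) (gen g) (gen h)
    Δ-carries k q g h@(⟪ suc (suc _) ⟫) e = Δ-carries-≥2 k q g h (s≤s (s≤s z≤n)) e
    Δ-carries k q g@(⟪ suc (suc _) ⟫) h@(⟪ suc zero ⟫) e =
      Δ-carries-reverse k q h g (Δ-carries-≥2 k q h g (s≤s (s≤s z≤n)) (trans (+-comm 1 (index g)) e))
    -- Two indices equal to 1 force k = 1, where `Δ 1` is σ_1 itself.
    Δ-carries (suc zero) q (⟪ suc zero ⟫) (⟪ suc zero ⟫) refl = ≈-refl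
    Δ-carries k q g h@(⟪ zero ⟫) e with () ← index-≥1 h
    Δ-carries k q g@(⟪ zero ⟫) (⟪ suc zero ⟫) e with () ← index-≥1 g

    Δ-carries-≥2 : ∀ k .(q : k < n) (g h : Generator n) → 2 ≤ index h → index g + index h ≡ suc k →
                   Carries (Δ k q) (gen g) (gen h)
    Δ-carries-≥2 k q g (⟪ suc zero ⟫) (s≤s ()) e
    Δ-carries-≥2 zero q g h 2≤h e
      with s≤s () ← ≤-trans 2≤h (subst (index h ≤_) e (m≤n+m (index h) (index g)))
    Δ-carries-≥2 (suc k) q g h@(⟪ suc (suc j) ⟫ {_} {r}) _ e =
      carries-++ {b = gen h⁻} {c = gen h} (δ (suc k) q) (Δ k _)
        (Δ-carries k _ g h⁻ g+h⁻≡1+k)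
        (δ-carries (suc k) q h⁻ h refl h≤1+k)
      where
      h⁻ : Generator n
      h⁻ = σ j (<⇒≤ r)
      g+h⁻≡1+k : index g + suc j ≡ suc k
      g+h⁻≡1+k = suc-injective (trans (sym (+-suc (index g) (suc j))) e)
      h≤1+k : suc (suc j) ≤ suc k
      h≤1+k = ≤-trans (+-monoˡ-≤ (suc j) (index-≥1 g)) (≤-reflexive g+h⁻≡1+k)

-- The flip as conjugation by the half twist.

flip-gen : ∀ {n} → Generator n → Generator n
flip-gen {n} (⟪ i ⟫ {p} {q}) = ⟪ n ∸ i ⟫ {m<n⇒0<n∸m q} {∸-monoʳ-< p (<⇒≤ q)}

flip : ∀ {n} → Word n → Word n
flip = map (map₁ flip-gen)

flip-involutive : ∀ {n} (w : Word n) → flip (flip w) ≡ w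
flip-involutive w = trans (sym (map-∘ w)) (trans (map-cong flip-letter w) (map-id w))
  where
  flip-letter : ∀ l → map₁ flip-gen (map₁ flip-gen l) ≡ l
  flip-letter (g , s) = cong (_, s) (generator-≡ (m∸[m∸n]≡n (<⇒≤ (index-< g))))

-- Since `suc m ∸ suc i` reduces to `m ∸ i`, the two composite maps agree on letters by computation.
flip-shift : ∀ {m} (w : Word m) → flip (shift w) ≡ ι (n≤1+n m) (flip w)
flip-shift w = trans (sym (map-∘ w)) (map-∘ w)

half-twist : ∀ n → Word n
half-twist zero    = []
half-twist (suc k) = Δ k ≤-refl

half-twist-carries-gen : ∀ {n} (g : Generator n) → Carries (half-twist n) (gen g) (gen (flip-gen g))
half-twist-carries-gen {zero}  g with () ← index-< g
-- The indices of `g` and its flip add up to the number of strands, `suc k`.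
half-twist-carries-gen {suc k} g = Δ-carries k ≤-refl g (flip-gen g) (m+[n∸m]≡n (<⇒≤ (index-< g)))

half-twist-carries : ∀ {n} (w : Word n) → Carries (half-twist n) w (flip w)
half-twist-carries []            = ≈-reflexive (++-identityʳ _)
half-twist-carries ((g , s) ∷ w) =
  carries-product [ (g , s) ] w [ (flip-gen g , s) ] (flip w) (letter s) (half-twist-carries w)
  where
  letter : ∀ s → Carries (half-twist _) [ (g , s) ] [ (flip-gen g , s) ]
  letter Sign.+ = half-twist-carries-gen g
  letter Sign.- = carries-invert (gen g) (gen (flip-gen g)) (half-twist-carries-gen g)

-- Comparison of the two equivalence relations.

∼-flip : ∀ m .(m>1 : 1 < m) (w : Word m) → ⟨ m , w , m>1 ⟩ ∼ ⟨ m , flip w , m>1 ⟩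
∼-flip m m>1 w =
  return (MarkovStep.conj m m>1 (half-twist m) w) ◅◅
  return (MarkovStep.same m m>1 (carries⇒conjugate (half-twist-carries w)))

≅-flip : ∀ m .(m>1 : 1 < m) (w : Word m) → ⟨ m , w , m>1 ⟩ ≅ ⟨ m , flip w , m>1 ⟩
≅-flip m m>1 w =
  return (ShiftStep.conj m m>1 (half-twist m) w) ◅◅
  return (ShiftStep.same m m>1 (carries⇒conjugate (half-twist-carries w)))

-- The flip in B_{m+1} sends index 1 to `suc m ∸ 1`, which reduces to `m`. The sign is arbitrary, so
-- both stabilisations are covered.
flip-first-shift : ∀ {m} .(m>1 : 1 < m) s (w : Word m) →
  flip ((σ-first m>1 , s) ∷ shift w) ≡ (σ-last m>1 , s) ∷ ι (n≤1+n m) (flip w)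
flip-first-shift m>1 s w = cong ((σ-last m>1 , s) ∷_) (flip-shift w)

flip-first-shift-flip : ∀ {m} .(m>1 : 1 < m) s (w : Word m) →
  flip ((σ-first m>1 , s) ∷ shift (flip w)) ≡ (σ-last m>1 , s) ∷ ι (n≤1+n m) w
flip-first-shift-flip {m} m>1 s w =
  trans (flip-first-shift m>1 s (flip w))
        (cong (λ v → (σ-last m>1 , s) ∷ ι (n≤1+n m) v) (flip-involutive w))

ShiftStep⇒∼ : ShiftStep ⇒ _∼_
ShiftStep⇒∼ (ShiftStep.same m m>1 b≈b′) = return (MarkovStep.same m m>1 b≈b′)
ShiftStep⇒∼ (ShiftStep.conj m m>1 a b)  = return (MarkovStep.conj m m>1 a b)
ShiftStep⇒∼ (ShiftStep.stab⁺ m m>1 w)   =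
  -- The chain is w ∼ flip w ∼ σ_m · ι (flip w) = flip (σ_1 · shift w) ∼ σ_1 · shift w.
  ∼-flip m m>1 w ◅◅
  return (MarkovStep.stab⁺ m m>1 (flip w)) ◅◅
  return (MarkovStep.same _ _ (≈-reflexive (sym (flip-first-shift m>1 Sign.+ w)))) ◅◅
  symmetric _ (∼-flip _ _ _)
ShiftStep⇒∼ (ShiftStep.stab⁻ m m>1 w)   =
  ∼-flip m m>1 w ◅◅
  return (MarkovStep.stab⁻ m m>1 (flip w)) ◅◅
  return (MarkovStep.same _ _ (≈-reflexive (sym (flip-first-shift m>1 Sign.- w)))) ◅◅
  symmetric _ (∼-flip _ _ _)

MarkovStep⇒≅ : MarkovStep ⇒ _≅_
MarkovStep⇒≅ (MarkovStep.same m m>1 b≈b′) = return (ShiftStep.same m m>1 b≈b′)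
MarkovStep⇒≅ (MarkovStep.conj m m>1 a b)  = return (ShiftStep.conj m m>1 a b)
MarkovStep⇒≅ (MarkovStep.stab⁺ m m>1 b)   =
  -- Flipping before stabilising makes the final flip restore `b`: b ≅ flip b ≅ σ_1 · shift (flip b)
  -- ≅ σ_m · ι b.
  ≅-flip m m>1 b ◅◅
  return (ShiftStep.stab⁺ m m>1 (flip b)) ◅◅
  ≅-flip _ _ _ ◅◅
  return (ShiftStep.same _ _ (≈-reflexive (flip-first-shift-flip m>1 Sign.+ b)))
MarkovStep⇒≅ (MarkovStep.stab⁻ m m>1 b)   =
  ≅-flip m m>1 b ◅◅
  return (ShiftStep.stab⁻ m m>1 (flip b)) ◅◅
  ≅-flip _ _ _ ◅◅
  return (ShiftStep.same _ _ (≈-reflexive (flip-first-shift-flip m>1 Sign.- b)))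

theorem4p4 : ∀ (x y : 𝓑) → (x ≅ y) ⇔ (x ∼ y)
theorem4p4 x y = mk⇔ (fold (isEquivalence _) ShiftStep⇒∼) (fold (isEquivalence _) MarkovStep⇒≅)
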